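{- The set $\Xi$ of all inconsistency pairs is transitive and normal.
   Context: $T$ is a complete consistent first-order theory (possibly many-sorted); we work in a big saturated model of $T$. All sets are small subsets of the big model; $BC$ means $B\cup C$. A tuple also denotes the set of its entries, and $\bar a\in A$ means that all entries of $\bar a$ lie in $A$. Inconsistency pairs: for a formula $\varphi(\bar x;\bar y)$ whose free variables are partitioned into two blocks, a parameter-free formula $\psi(\bar y_0,\dots,\bar y_{k-1})$ (also written $\psi(\bar y_{<k})$) is a $k$-inconsistency witness for $\varphi(\bar x;\bar y)$ if $\big(\bigwedge_{i<k}\varphi(\bar x;\bar y_i)\big)\wedge\psi(\bar y_{<k})$ is inconsistent. $\Xi$ is the set of all pairs $(\varphi(\bar x;\bar y),\psi(\bar y_{<k}))$, $k<\omega$, such that $\psi$ is a $k$-inconsistency witness for $\varphi$. For $(\varphi,\psi)\in\Xi$, a formula $\varphi(\bar x;\bar b)$ $(\varphi,\psi)$-divides over $C$ if there is a sequence $(\bar b_i)_{i<\omega}$ such that each $\bar b_i$ realises $\operatorname{tp}(\bar b/C)$ and $\models\psi(\bar b_{i_0},\dots,\bar b_{i_{k-1}})$ for all $i_0<\dots<i_{k-1}<\omega$. For $\Omega\subseteq\Xi$, a partial type $\Omega$-divides over $C$ if for some $(\varphi,\psi)\in\Omega$ it contains a formula $\varphi(\bar x;\bar b)$ that $(\varphi,\psi)$-divides over $C$. Define $A\perp^{\Omega}_CB$ iff there is no $\bar a\in A$ such that $\operatorname{tp}(\bar a/BC)$ $\Omega$-divides over $C$. - $\Omega$ is transitive if: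 whenever $(\varphi(\bar y;\bar x),\psi(\bar x_{<k}))\in\Omega$, $D\subseteq C$, $C\perp^\Omega_D\bar a$ and $\varphi(\bar y;\bar a)$ $(\varphi,\psi)$-divides over $D$, then $\varphi(\bar y;\bar a)$ $(\varphi,\psi)$-divides over $C$. - $\Omega$ is normal if: whenever $(\varphi(\bar x,\bar z;\bar y),\psi(\bar y_{<k}))\in\Omega$, then also $(\varphi(\bar x;\bar z,\bar y),\psi'(\bar y_{<k},\bar z_{<k}))\in\Omega$, where $\psi'(\bar y_{<k},\bar z_{<k})$ is $\psi(\bar y_{<k})\wedge(\bar z_0=\bar z_1=\dots=\bar z_{k-1})$. -}

module Defs where

open import Data.Empty.Polymorphic using (⊥)
open import Data.Fin using (Fin; suc; inject₁; _<_)
open import Data.List using (List; []; _∷_; _++_; foldr; map; allFin)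
open import Data.List.Membership.Propositional using (_∈_; mapWith∈)
open import Data.List.Membership.Propositional.Properties using (∈-++⁺ˡ; ∈-++⁺ʳ; ∈-++⁻)
open import Data.List.Relation.Unary.All using (All; []; _∷_)
open import Data.List.Relation.Unary.Any using (here; there)
open import Data.Nat as ℕ using (ℕ; zero; suc)
open import Data.Product using (Σ-syntax; ∃-syntax; _×_; _,_)
open import Data.Sum using (_⊎_; inj₁; inj₂; [_,_])
open import Function using (_∘_)
open import Level using (Level; _⊔_) renaming (suc to lsuc)
open import Relation.Binary.PropositionalEquality using (_≡_; refl)
open import Relation.Nullary using (¬_)
open import Relation.Unary using (Pred; _⊆′_; _∪_; ｛_｝)

-- The universe Set ℓ plays the role of "small": the language has small many
-- symbols, and a small set is one indexed by types in Set ℓ.  The carriers of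
-- structures, in particular of the big model, live in a separate universe Set m.

record Language (ℓ : Level) : Set (lsuc ℓ) where
  field
    Sort : Set ℓ
    Fun  : List Sort → Sort → Set ℓ
    Rel  : List Sort → Set ℓ

infixr 6 _▹_

_▹_ : ∀ {a v w p} {A : Set a} {V : Pred A v} {W : Pred A w} {P : Pred A p} →
      V ⊆′ P → W ⊆′ P → (V ∪ W) ⊆′ P
(f ▹ g) s = [ f s , g s ]

-- Variables are given by a sorted family V (V s is the type of variables of
-- sort s).  A finite tuple of variables x̄ is the family (_∈ X), for X the list
-- of the sorts of its entries; two blocks (x̄;ȳ) are a union of families.

module _ {ℓ : Level} (L : Language ℓ) where
  open Language L

  Vars : Set (lsuc ℓ)
  Vars = Pred Sort ℓ

  data Term (V : Vars) : Sort → Set ℓ where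
    var : ∀ {s} → V s → Term V s
    fun : ∀ {Γ s} → Fun Γ s → All (Term V) Γ → Term V s

  infixr 6 _∧'_
  infixr 5 _⇒'_
  infix  7 _≈'_

  data Formula (V : Vars) : Set ℓ where
    rel  : ∀ {Γ} → Rel Γ → All (Term V) Γ → Formula V
    _≈'_ : ∀ {s} → Term V s → Term V s → Formula V
    ⊥'   : Formula V
    _∧'_ : Formula V → Formula V → Formula V
    _⇒'_ : Formula V → Formula V → Formula V
    ∀'   : ∀ s → Formula (V ∪ ｛ s ｝) → Formula V

module _ {ℓ : Level} {L : Language ℓ} where
  open Language L

  infix 8 ¬'_

  ¬'_ : ∀ {V : Vars L} → Formula L V → Formula L V
  ¬' φ = φ ⇒' ⊥'

  ⊤' : ∀ {V : Vars L} → Formula L V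
  ⊤' = ¬' ⊥'

  ⋀ : ∀ {V : Vars L} → List (Formula L V) → Formula L V
  ⋀ = foldr _∧'_ ⊤'

  module _ {V W : Vars L} (f : V ⊆′ W) where
    mutual
      renameTerm : ∀ {s} → Term L V s → Term L W s
      renameTerm (var v)    = var (f _ v)
      renameTerm (fun g ts) = fun g (renameTerms ts)

      renameTerms : ∀ {Γ} → All (Term L V) Γ → All (Term L W) Γ
      renameTerms []       = []
      renameTerms (t ∷ ts) = renameTerm t ∷ renameTerms ts

  rename : ∀ {V W : Vars L} → V ⊆′ W → Formula L V → Formula L W
  rename f (rel R ts) = rel R (renameTerms f ts)
  rename f (t ≈' u)   = renameTerm f t ≈' renameTerm f u
  rename f ⊥'         = ⊥'
  rename f (φ ∧' ψ)   = rename f φ ∧' rename f ψ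
  rename f (φ ⇒' ψ)   = rename f φ ⇒' rename f ψ
  rename f (∀' s φ)   = ∀' s (rename ((λ t → inj₁ ∘ f t) ▹ (λ t → inj₂)) φ)

  ∀* : ∀ {V : Vars L} (Γ : List Sort) → Formula L ((_∈ Γ) ∪ V) → Formula L V
  ∀* {V} [] φ = rename strip φ
    where
    strip : ((_∈ []) ∪ V) ⊆′ V
    strip t (inj₂ v) = v
  ∀* {V} (s ∷ Γ) φ = ∀' s (∀* Γ (rename shift φ))
    where
    shift : ((_∈ (s ∷ Γ)) ∪ V) ⊆′ ((_∈ Γ) ∪ (V ∪ ｛ s ｝))
    shift t (inj₁ (here refl)) = inj₂ (inj₂ refl)
    shift t (inj₁ (there x))   = inj₁ x
    shift t (inj₂ v)           = inj₂ (inj₁ v)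

  -- The object logic is classical: ∃ is an abbreviation for ¬∀¬.
  ∃* : ∀ {V : Vars L} (Γ : List Sort) → Formula L ((_∈ Γ) ∪ V) → Formula L V
  ∃* Γ φ = ¬' ∀* Γ (¬' φ)

Sentence : ∀ {ℓ} → Language ℓ → Set ℓ
Sentence L = Formula L (_∈ [])

record Structure {ℓ : Level} (L : Language ℓ) (m : Level) : Set (ℓ ⊔ lsuc m) where
  open Language L
  field
    Carrier   : Sort → Set m
    inhabited : ∀ s → Carrier s
    funᴹ      : ∀ {Γ s} → Fun Γ s → All Carrier Γ → Carrier s
    relᴹ      : ∀ {Γ} → Rel Γ → All Carrier Γ → Set m

module _ {ℓ m : Level} {L : Language ℓ} (M : Structure L m) where
  open Language L
  open Structure M

  module _ {V : Vars L} (ρ : V ⊆′ Carrier) where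
    mutual
      eval : ∀ {s} → Term L V s → Carrier s
      eval (var v)    = ρ _ v
      eval (fun f ts) = funᴹ f (evals ts)

      evals : ∀ {Γ} → All (Term L V) Γ → All Carrier Γ
      evals []       = []
      evals (t ∷ ts) = eval t ∷ evals ts

  infix 4 _⊨_[_] _⊨ₛ_ _⊨ᵀ_

  _⊨_[_] : ∀ {V : Vars L} → Formula L V → V ⊆′ Carrier → Set m
  _⊨_[_] (rel R ts) ρ = relᴹ R (evals ρ ts)
  _⊨_[_] (t ≈' u)   ρ = eval ρ t ≡ eval ρ u
  _⊨_[_] ⊥'         ρ = ⊥
  _⊨_[_] (φ ∧' ψ)   ρ = _⊨_[_] φ ρ × _⊨_[_] ψ ρ
  _⊨_[_] (φ ⇒' ψ)   ρ = _⊨_[_] φ ρ → _⊨_[_] ψ ρ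
  _⊨_[_] (∀' s φ)   ρ = (a : Carrier s) → _⊨_[_] φ (ρ ▹ (λ { t refl → a }))

  _⊨ₛ_ : Sentence L → Set m
  _⊨ₛ_ σ = _⊨_[_] σ (λ _ ())

  _⊨ᵀ_ : ∀ {t} → Pred (Sentence L) t → Set (ℓ ⊔ m ⊔ t)
  _⊨ᵀ_ T = ∀ σ → T σ → _⊨ₛ_ σ

Theory : ∀ {ℓ} → Language ℓ → Set (lsuc ℓ)
Theory {ℓ} L = Pred (Sentence L) ℓ

module _ {ℓ : Level} (m : Level) {L : Language ℓ} (T : Theory L) where

  Entails : Sentence L → Set (ℓ ⊔ lsuc m)
  Entails σ = (N : Structure L m) → N ⊨ᵀ T → N ⊨ₛ σ

  Consistent : Set (ℓ ⊔ lsuc m)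
  Consistent = Σ[ N ∈ Structure L m ] (N ⊨ᵀ T)

  Complete : Set (ℓ ⊔ lsuc m)
  Complete = ∀ σ → Entails σ ⊎ Entails (¬' σ)

  -- Inconsistent with T.
  Inconsistent : ∀ {V : Vars L} → Formula L V → Set (ℓ ⊔ lsuc m)
  Inconsistent {V} χ =
    (N : Structure L m) → N ⊨ᵀ T → (ρ : V ⊆′ Structure.Carrier N) → ¬ (N ⊨ χ [ ρ ])

-- The variables of the k copies ȳ₀, …, ȳₖ₋₁ of a tuple ȳ.
Copies : ∀ {a} {A : Set a} → ℕ → List A → Pred A a
Copies k Y s = Fin k × s ∈ Y

-- A pair (φ(x̄;ȳ), ψ(ȳ_{<k})), not yet required to be an inconsistency pair.
record FormulaPair {ℓ : Level} (L : Language ℓ) (X Y : List (Language.Sort L)) : Set ℓ where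
  constructor pair
  field
    {k} : ℕ
    φ   : Formula L ((_∈ X) ∪ (_∈ Y))
    ψ   : Formula L (Copies k Y)

PairSet : ∀ {ℓ} → Language ℓ → (p : Level) → Set (ℓ ⊔ lsuc p)
PairSet L p = ∀ {X Y} → Pred (FormulaPair L X Y) p

Ξ : ∀ {ℓ} (m : Level) {L : Language ℓ} (T : Theory L) → PairSet L (ℓ ⊔ lsuc m)
Ξ m {L} T {X} {Y} (pair {k} φ ψ) =
  Inconsistent m T (⋀ (map (λ i → rename (at i) φ) (allFin k)) ∧' rename (λ _ → inj₂) ψ)
  where
  at : Fin k → ((_∈ X) ∪ (_∈ Y)) ⊆′ ((_∈ X) ∪ Copies k Y)
  at i s (inj₁ x) = inj₁ x
  at i s (inj₂ y) = inj₂ (i , y)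

module _ {ℓ : Level} {L : Language ℓ} where
  open Language L

  -- z̄₀ = z̄₁ = … = z̄ₖ₋₁ (the empty conjunction when k ≤ 1).
  allEqual : ∀ k (Z : List Sort) → Formula L (Copies k Z)
  allEqual zero    Z = ⊤'
  allEqual (suc n) Z =
    ⋀ (map (λ i → ⋀ (mapWith∈ Z λ z → var (inject₁ i , z) ≈' var (suc i , z))) (allFin n))

  -- From (φ(x̄,z̄;ȳ), ψ) to (φ(x̄;z̄,ȳ), ψ').
  shiftBlock : ∀ X Z {Y} → FormulaPair L (X ++ Z) Y → FormulaPair L X (Z ++ Y)
  shiftBlock X Z {Y} (pair {k} φ ψ) =
    pair (rename regroup φ) (rename inY ψ ∧' rename inZ (allEqual k Z))
    where
    regroup : ((_∈ (X ++ Z)) ∪ (_∈ Y)) ⊆′ ((_∈ X) ∪ (_∈ (Z ++ Y)))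
    regroup s (inj₁ v) = [ inj₁ , inj₂ ∘ ∈-++⁺ˡ ] (∈-++⁻ X v)
    regroup s (inj₂ y) = inj₂ (∈-++⁺ʳ Z y)

    inY : Copies k Y ⊆′ Copies k (Z ++ Y)
    inY s (i , y) = i , ∈-++⁺ʳ Z y

    inZ : Copies k Z ⊆′ Copies k (Z ++ Y)
    inZ s (i , z) = i , ∈-++⁺ˡ z

  Normal : ∀ {p} → PairSet L p → Set (ℓ ⊔ p)
  Normal Ω = ∀ X Z {Y} (π : FormulaPair L (X ++ Z) Y) → Ω π → Ω (shiftBlock X Z π)

module _ {ℓ m : Level} {L : Language ℓ} (M : Structure L m) where
  open Language L
  open Structure M

  Tuple : List Sort → Set (ℓ ⊔ m)
  Tuple X = (_∈ X) ⊆′ Carrier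

  record SmallSet : Set (lsuc ℓ ⊔ m) where
    constructor smallSet
    field
      Index : Vars L
      elem  : Index ⊆′ Carrier

  open SmallSet

  entries : ∀ {X} → Tuple X → SmallSet
  entries {X} a = smallSet (_∈ X) a

  infixr 6 _∪ₛ_
  infix  4 _⊆ₛ_

  _∪ₛ_ : SmallSet → SmallSet → SmallSet
  A ∪ₛ B = smallSet (Index A ∪ Index B) (elem A ▹ elem B)

  _⊆ₛ_ : SmallSet → SmallSet → Set (ℓ ⊔ m)
  A ⊆ₛ B = ∀ s (i : Index A s) → ∃[ j ] elem B s j ≡ elem A s i

  -- Formulas over C in the variables x̄: the elements of Index C serve as the
  -- constants naming the elements of C, so they are always evaluated by elem C.
  FormulaOver : SmallSet → List Sort → Set ℓ
  FormulaOver C X = Formula L ((_∈ X) ∪ Index C)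

  PartialType : (r : Level) → SmallSet → List Sort → Set (ℓ ⊔ lsuc r)
  PartialType r C X = Pred (FormulaOver C X) r

  Realises : ∀ {r X} (C : SmallSet) → Tuple X → PartialType r C X → Set (ℓ ⊔ m ⊔ r)
  Realises C a p = ∀ χ → p χ → M ⊨ χ [ a ▹ elem C ]

  FinitelySatisfiable : ∀ {r X} (C : SmallSet) → PartialType r C X → Set (ℓ ⊔ m ⊔ r)
  FinitelySatisfiable {X = X} C p = ∀ χs → All p χs → M ⊨ ∃* X (⋀ χs) [ elem C ]

  Saturated : Set (lsuc (ℓ ⊔ m))
  Saturated = ∀ C X (p : PartialType (ℓ ⊔ m) C X) → FinitelySatisfiable C p →
              Σ[ a ∈ Tuple X ] Realises C a p

  tp : ∀ {X} → Tuple X → (C : SmallSet) → PartialType m C X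
  tp a C χ = M ⊨ χ [ a ▹ elem C ]

  -- PairDivides (pair φ ψ) b̄ C: the formula φ(x̄;b̄) (φ,ψ)-divides over C.
  PairDivides : ∀ {X Y} → FormulaPair L X Y → Tuple Y → SmallSet → Set (ℓ ⊔ m)
  PairDivides {X} {Y} (pair {k} φ ψ) b C =
    Σ[ bs ∈ (ℕ → Tuple Y) ]
      (∀ i → Realises C (bs i) (tp b C)) ×
      ((i : Fin k → ℕ) → (∀ {u v} → u < v → i u ℕ.< i v) →
        M ⊨ ψ [ (λ { s (u , y) → bs (i u) s y }) ])

  -- Divides Ω D p C: the partial type p over D Ω-divides over C.  The parameters
  -- b̄ of the formula φ(x̄;b̄) in p are elements of D, given by their indices.
  Divides : ∀ {p r X} → PairSet L p → (D : SmallSet) → PartialType r D X → SmallSet →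
            Set (ℓ ⊔ m ⊔ p ⊔ r)
  Divides {X = X} Ω D p C =
    ∃[ Y ] Σ[ π ∈ FormulaPair L X Y ] Σ[ b ∈ (_∈ Y) ⊆′ Index D ]
      Ω π ×
      p (rename ((λ _ → inj₁) ▹ (λ s → inj₂ ∘ b s)) (FormulaPair.φ π)) ×
      PairDivides π (λ s → elem D s ∘ b s) C

  -- Independent Ω A C B is  A ⊥^Ω_C B.
  Independent : ∀ {p} → PairSet L p → (A C B : SmallSet) → Set (ℓ ⊔ m ⊔ p)
  Independent Ω A C B =
    ¬ (∃[ X ] Σ[ a ∈ (_∈ X) ⊆′ Index A ]
        Divides Ω (B ∪ₛ C) (tp (λ s → elem A s ∘ a s) (B ∪ₛ C)) C)

  Transitive : ∀ {p} → PairSet L p → Set (lsuc ℓ ⊔ m ⊔ p)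
  Transitive Ω =
    ∀ {Y X} (π : FormulaPair L Y X) → Ω π → ∀ (C D : SmallSet) (a : Tuple X) →
    D ⊆ₛ C → Independent Ω C D (entries a) →
    PairDivides π a D → PairDivides π a C

record BigModel {ℓ : Level} (m : Level) {L : Language ℓ} (T : Theory L) : Set (lsuc (ℓ ⊔ m)) where
  field
    model     : Structure L m
    isModel   : model ⊨ᵀ T
    saturated : Saturated model

{-# OPTIONS --safe #-}

-- Transitivity is a compactness argument.  Suppose tp(a/C) has no sequence of
-- realisations that satisfies ψ along increasing indices.  By saturation, some
-- χ(x,c) in tp(a/C) and finitely many instances of ψ have no common solution.
-- Let θ(z) say that χ(x₀,z), …, χ(x_N,z) and these instances of ψ have no common
-- solution.  Then χ(x,z) ∧ θ(z) and the conjunction of the instances form an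
-- inconsistency pair for free, the formula χ(a,z) ∧ θ(z) is satisfied by c, and
-- the sequence witnessing division over D shows that it divides over D; this
-- contradicts the independence of C from a over D.
--
-- Normality: on instances with equal z̄ᵢ, the shifted pair is the original one
-- with this common value moved into the variables on the left.
module Submission where

open import Defs
open import Data.Empty using (⊥-elim)
open import Data.Fin using (Fin; zero; suc; toℕ) renaming (_<_ to _<ᶠ_)
open import Data.Fin.Induction using (<-weakInduction)
open import Data.Fin.Properties using (toℕ-fromℕ<; toℕ-injective; toℕ<n)
open import Data.List using (List; []; _∷_; _++_; map; allFin)
open import Data.List.Membership.Propositional using (_∈_; mapWith∈)
open import Data.List.Membership.Propositional.Properties
  using (∈-++⁺ˡ; ∈-++⁺ʳ; ∈-++⁻; ∈-allFin)
open import Data.List.Relation.Unary.All as All using (All; []; _∷_)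
open import Data.List.Relation.Unary.All.Properties
  using (map⁺; map⁻; tabulate⁺; tabulate⁻; ++⁺; ++⁻ˡ; ++⁻ʳ)
open import Data.List.Relation.Unary.Any using (here; there)
open import Data.List.Relation.Unary.Any.Properties using (++⁻∘++⁺)
open import Data.Nat as ℕ using (ℕ; zero; suc; _≤_; _<_; _≟_; _⊔_; _∸_; _+_; s≤s)
open import Data.Nat.DivMod using (_mod_; m<n⇒m%n≡m)
open import Data.Nat.Properties
open import Data.Product using (Σ-syntax; _×_; _,_; proj₁; proj₂)
open import Data.Product.Function.NonDependent.Propositional using (_×-⇔_)
open import Data.Sum using (inj₁; inj₂; [_,_])
open import Function using (_∘_; id; _⇔_; mk⇔; Equivalence)
open import Function.Construct.Composition using () renaming (equivalence to ⇔-trans)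
open import Function.Construct.Identity using (⇔-id)
open import Function.Construct.Symmetry using (⇔-sym)
open import Function.Properties.Equivalence using (⇔-isEquivalence)
open import Function.Related.TypeIsomorphisms using (→-cong-⇔)
open import Level as Level using (Level; lift; lower)
open import Relation.Binary.Structures using (IsEquivalence)
open import Relation.Binary.PropositionalEquality using (_≡_; _≢_; refl; sym; trans; cong; cong₂; subst)
open import Relation.Nullary using (¬_; yes; no)
open import Relation.Unary using (Pred; _⊆′_; _∪_; ｛_｝)

open Equivalence using (to; from)

-- Equivalences, list positions and bounds

≡⇒⇔ : ∀ {a} {A B : Set a} → A ≡ B → A ⇔ B
≡⇒⇔ = IsEquivalence.reflexive ⇔-isEquivalence

Π-⇔ : ∀ {a b} {A : Set a} {P Q : A → Set b} → (∀ x → P x ⇔ Q x) → (∀ x → P x) ⇔ (∀ x → Q x)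
Π-⇔ e = mk⇔ (λ h x → to (e x) (h x)) (λ h x → from (e x) (h x))

∈-++⁻∘⁺ˡ : ∀ {a} {A : Set a} {x : A} xs ys (p : x ∈ xs) → ∈-++⁻ xs {ys} (∈-++⁺ˡ p) ≡ inj₁ p
∈-++⁻∘⁺ˡ xs ys p = ++⁻∘++⁺ xs {ys} (inj₁ p)

∈-++⁻∘⁺ʳ : ∀ {a} {A : Set a} {x : A} xs ys (p : x ∈ ys) → ∈-++⁻ xs {ys} (∈-++⁺ʳ xs p) ≡ inj₂ p
∈-++⁻∘⁺ʳ xs ys p = ++⁻∘++⁺ xs {ys} (inj₂ p)

-- `r` depends on the position and not only on the entry: in `blockBound` the list consists of
-- sorts, and one sort may occur at several positions with different blocks.
bounded : ∀ {a} {A : Set a} (xs : List A) (r : ∀ x → x ∈ xs → ℕ) →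
          Σ[ n ∈ ℕ ] (∀ x (p : x ∈ xs) → r x p < n)
bounded []       r = 0 , λ _ ()
bounded (x ∷ xs) r with bounded xs (λ y → r y ∘ there)
... | n , r<n = suc (r x (here refl)) ⊔ n , λ where
  y (here refl) → m≤m⊔n _ n
  y (there p)   → ≤-trans (r<n y p) (m≤n⊔m _ n)

-- Values above N wrap around.
clamp : ∀ N → ℕ → Fin (suc N)
clamp N i = i mod suc N

toℕ-clamp : ∀ N {i} → i < suc N → toℕ (clamp N i) ≡ i
toℕ-clamp N i<N = trans (toℕ-fromℕ< _) (m<n⇒m%n≡m i<N)

clamp-toℕ : ∀ N (u : Fin (suc N)) → clamp N (toℕ u) ≡ u
clamp-toℕ N u = toℕ-injective (toℕ-clamp N (toℕ<n u))

Increasing : ∀ {k} → (Fin k → ℕ) → Set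
Increasing g = ∀ {u v} → u <ᶠ v → g u < g v

-- Semantics of renaming and of block quantifiers

module _ {ℓ m : Level} {L : Language ℓ} (M : Structure L m) where
  open Language L
  open Structure M

  module _ {V W : Vars L} (f : V ⊆′ W) {ρ : V ⊆′ Carrier} {ρ′ : W ⊆′ Carrier}
           (eq : ∀ s v → ρ′ s (f s v) ≡ ρ s v) where
    mutual
      eval-rename : ∀ {s} (t : Term L V s) → eval M ρ′ (renameTerm f t) ≡ eval M ρ t
      eval-rename (var v)    = eq _ v
      eval-rename (fun g ts) = cong (funᴹ g) (evals-rename ts)

      evals-rename : ∀ {Γ} (ts : All (Term L V) Γ) →
                     evals M ρ′ (renameTerms f ts) ≡ evals M ρ ts
      evals-rename []       = refl
      evals-rename (t ∷ ts) = cong₂ _∷_ (eval-rename t) (evals-rename ts)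

  ⊨-rename : ∀ {V W : Vars L} (f : V ⊆′ W) (φ : Formula L V)
             {ρ : V ⊆′ Carrier} {ρ′ : W ⊆′ Carrier} → (∀ s v → ρ′ s (f s v) ≡ ρ s v) →
             M ⊨ rename f φ [ ρ′ ] ⇔ M ⊨ φ [ ρ ]
  ⊨-rename f (rel R ts) eq = ≡⇒⇔ (cong (relᴹ R) (evals-rename f eq ts))
  ⊨-rename f (t ≈' u)   eq = ≡⇒⇔ (cong₂ _≡_ (eval-rename f eq t) (eval-rename f eq u))
  ⊨-rename f ⊥'         eq = ⇔-id _
  ⊨-rename f (φ ∧' ψ)   eq = ⊨-rename f φ eq ×-⇔ ⊨-rename f ψ eq
  ⊨-rename f (φ ⇒' ψ)   eq = →-cong-⇔ (⊨-rename f φ eq) (⊨-rename f ψ eq)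
  ⊨-rename f (∀' s φ)   eq = Π-⇔ λ a → ⊨-rename _ φ λ where
    t (inj₁ v)    → eq t v
    t (inj₂ refl) → refl

  -- Pointwise equal assignments need not be equal as functions, so both are compared through a
  -- renaming along the identity.
  ⊨-ext : ∀ {V : Vars L} (φ : Formula L V) {ρ ρ′ : V ⊆′ Carrier} →
          (∀ s v → ρ s v ≡ ρ′ s v) → M ⊨ φ [ ρ ] ⇔ M ⊨ φ [ ρ′ ]
  ⊨-ext φ eq = ⇔-trans (⇔-sym (⊨-rename (λ _ → id) φ (λ _ _ → refl)))
                       (⊨-rename (λ _ → id) φ eq)

  ⊨-rename² : ∀ {U V W : Vars L} (f : U ⊆′ V) (g : V ⊆′ W) (φ : Formula L U)
              {ρ : U ⊆′ Carrier} {ρ′ : W ⊆′ Carrier} → (∀ s v → ρ′ s (g s (f s v)) ≡ ρ s v) →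
              M ⊨ rename g (rename f φ) [ ρ′ ] ⇔ M ⊨ φ [ ρ ]
  ⊨-rename² f g φ eq =
    ⇔-trans (⊨-rename g (rename f φ) λ _ _ → refl) (⊨-rename f φ eq)

  ⊨-⋀ : ∀ {V : Vars L} (φs : List (Formula L V)) {ρ : V ⊆′ Carrier} →
        M ⊨ ⋀ φs [ ρ ] ⇔ All (λ φ → M ⊨ φ [ ρ ]) φs
  ⊨-⋀ []       = mk⇔ (λ _ → []) (λ _ → id)
  ⊨-⋀ (φ ∷ φs) = mk⇔ (λ { (h , hs) → h ∷ to (⊨-⋀ φs) hs }) (λ { (h ∷ hs) → h , from (⊨-⋀ φs) hs })

  ⊨-⋀-allFin : ∀ {V : Vars L} {k} (φ : Fin k → Formula L V) {ρ : V ⊆′ Carrier} →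
               M ⊨ ⋀ (map φ (allFin k)) [ ρ ] ⇔ (∀ i → M ⊨ φ i [ ρ ])
  ⊨-⋀-allFin {k = k} φ = mk⇔ (tabulate⁻ ∘ map⁻ ∘ to (⊨-⋀ (map φ (allFin k))))
                         (from (⊨-⋀ (map φ (allFin k))) ∘ map⁺ ∘ tabulate⁺)

  ⊨-⋀-mapWith∈ : ∀ {V : Vars L} (Z : List Sort) (φ : ∀ {s} → s ∈ Z → Formula L V)
                 {ρ : V ⊆′ Carrier} → M ⊨ ⋀ (mapWith∈ Z φ) [ ρ ] →
                 ∀ {s} (z : s ∈ Z) → M ⊨ φ z [ ρ ]
  ⊨-⋀-mapWith∈ (_ ∷ Z) φ (h , hs) (here refl) = h
  ⊨-⋀-mapWith∈ (_ ∷ Z) φ (h , hs) (there z)   = ⊨-⋀-mapWith∈ Z (φ ∘ there) hs z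

  ⊨-∀* : ∀ {V : Vars L} Γ (φ : Formula L ((_∈ Γ) ∪ V)) {ρ : V ⊆′ Carrier} →
         M ⊨ ∀* Γ φ [ ρ ] ⇔ (∀ (t : Tuple M Γ) → M ⊨ φ [ t ▹ ρ ])
  ⊨-∀* [] φ = mk⇔
    (λ h t → to (⊨-rename _ φ λ { _ (inj₂ v) → refl }) h)
    (λ h → from (⊨-rename _ φ λ { _ (inj₂ v) → refl }) (h λ _ ()))
  ⊨-∀* (s ∷ Γ) φ = mk⇔
    (λ h t → to (⊨-rename _ φ λ { _ (inj₁ (here refl)) → refl
                                ; _ (inj₁ (there x))   → refl
                                ; _ (inj₂ v)           → refl })
                (to (⊨-∀* Γ _) (h (t s (here refl))) (λ r → t r ∘ there)))
    (λ h b → from (⊨-∀* Γ _) λ t →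
      from (⊨-rename _ φ λ { _ (inj₁ (here refl)) → refl
                           ; _ (inj₁ (there x))   → refl
                           ; _ (inj₂ v)           → refl })
           (h λ { _ (here refl) → b ; _ (there x) → t _ x }))

  -- As ∃ abbreviates ¬∀¬, a witness is available only up to double negation. This is the source of
  -- the double negations in the satisfiability statements below.
  ⊨-∃* : ∀ {V : Vars L} Γ (φ : Formula L ((_∈ Γ) ∪ V)) {ρ : V ⊆′ Carrier} →
         M ⊨ ∃* Γ φ [ ρ ] ⇔ (¬ ¬ (Σ[ t ∈ Tuple M Γ ] M ⊨ φ [ t ▹ ρ ]))
  ⊨-∃* Γ φ = mk⇔
    (λ h none → lower (h (from (⊨-∀* Γ _) λ t hφ → lift (none (t , hφ)))))
    (λ h hall → lift (h λ { (t , hφ) → lower (to (⊨-∀* Γ _) hall t hφ) }))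

-- Finite support

merge : ∀ {a p} {A : Set a} {P : Pred A p} {xs ys : List A} →
        (_∈ xs) ⊆′ P → (_∈ ys) ⊆′ P → (_∈ (xs ++ ys)) ⊆′ P
merge {xs = xs} c d s p = [ c s , d s ] (∈-++⁻ xs p)

-- `f` sorts the variables of `φ` into those to keep, `V`, and those from which a finite tuple is
-- extracted, `I`. The structure is quantified last, so that tuple and formula do not depend on it;
-- `rank` relies on this. Allowing an arbitrary `f` lets the recursion pass under a quantifier.
record Support {ℓ : Level} (m : Level) {L : Language ℓ} {U V I : Vars L}
               (f : U ⊆′ (V ∪ I)) (φ : Formula L U) : Set (ℓ Level.⊔ Level.suc m) where
  constructor support
  field
    {tuple} : List (Language.Sort L)
    index   : (_∈ tuple) ⊆′ I
    formula : Formula L (V ∪ (_∈ tuple))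
    ⊨-formula : (M : Structure L m) (ρ : V ⊆′ Structure.Carrier M) (σ : I ⊆′ Structure.Carrier M) →
                M ⊨ φ [ (λ s → (ρ ▹ σ) s ∘ f s) ] ⇔ M ⊨ formula [ ρ ▹ (λ s → σ s ∘ index s) ]

module FiniteSupport {ℓ : Level} (m : Level) {L : Language ℓ} where
  open Language L
  open Structure using (Carrier)

  private variable
    U V I : Vars L
    Z Z′ : List Sort

  weakenˡ : (V : Vars L) → (V ∪ (_∈ Z)) ⊆′ (V ∪ (_∈ (Z ++ Z′)))
  weakenˡ V = (λ _ → inj₁) ▹ (λ _ → inj₂ ∘ ∈-++⁺ˡ)

  weakenʳ : ∀ (V : Vars L) Z → (V ∪ (_∈ Z′)) ⊆′ (V ∪ (_∈ (Z ++ Z′)))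
  weakenʳ V Z = (λ _ → inj₁) ▹ (λ _ → inj₂ ∘ ∈-++⁺ʳ Z)

  module _ (M : Structure L m) (ρ : V ⊆′ Carrier M) (σ : I ⊆′ Carrier M)
           (c : (_∈ Z) ⊆′ I) (d : (_∈ Z′) ⊆′ I) where

    private
      τ : (V ∪ (_∈ (Z ++ Z′))) ⊆′ Carrier M
      τ = ρ ▹ (λ s → σ s ∘ merge c d s)

    weakenˡ-merge : ∀ s v → τ s (weakenˡ V s v) ≡ (ρ ▹ (λ s → σ s ∘ c s)) s v
    weakenˡ-merge s (inj₁ v) = refl
    weakenˡ-merge s (inj₂ z) = cong (σ s ∘ [ c s , d s ]) (∈-++⁻∘⁺ˡ Z Z′ z)

    weakenʳ-merge : ∀ s v → τ s (weakenʳ V Z s v) ≡ (ρ ▹ (λ s → σ s ∘ d s)) s v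
    weakenʳ-merge s (inj₁ v) = refl
    weakenʳ-merge s (inj₂ z) = cong (σ s ∘ [ c s , d s ]) (∈-++⁻∘⁺ʳ Z Z′ z)

  SupportTerm : U ⊆′ (V ∪ I) → ∀ {s} → Term L U s → Set (ℓ Level.⊔ Level.suc m)
  SupportTerm {U} {V} {I} f {s} t =
    Σ[ Z ∈ List Sort ] Σ[ c ∈ (_∈ Z) ⊆′ I ] Σ[ t° ∈ Term L (V ∪ (_∈ Z)) s ]
    (∀ (M : Structure L m) (ρ : V ⊆′ Carrier M) (σ : I ⊆′ Carrier M) →
      eval M (λ s → (ρ ▹ σ) s ∘ f s) t ≡ eval M (ρ ▹ (λ s → σ s ∘ c s)) t°)

  SupportTerms : U ⊆′ (V ∪ I) → ∀ {Γ} → All (Term L U) Γ → Set (ℓ Level.⊔ Level.suc m)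
  SupportTerms {U} {V} {I} f {Γ} ts =
    Σ[ Z ∈ List Sort ] Σ[ c ∈ (_∈ Z) ⊆′ I ] Σ[ ts° ∈ All (Term L (V ∪ (_∈ Z))) Γ ]
    (∀ (M : Structure L m) (ρ : V ⊆′ Carrier M) (σ : I ⊆′ Carrier M) →
      evals M (λ s → (ρ ▹ σ) s ∘ f s) ts ≡ evals M (ρ ▹ (λ s → σ s ∘ c s)) ts°)

  mutual
    supportTerm : (f : U ⊆′ (V ∪ I)) → ∀ {s} (t : Term L U s) → SupportTerm f t
    supportTerm f {s} (var v) with f s v
    ... | inj₁ w = [] , (λ _ ()) , var (inj₁ w) , λ M ρ σ → refl
    ... | inj₂ i = s ∷ [] , (λ { _ (here refl) → i }) , var (inj₂ (here refl)) , λ M ρ σ → refl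
    supportTerm f (fun g ts) with supportTerms f ts
    ... | Z , c , ts° , e = Z , c , fun g ts° , λ M ρ σ → cong (Structure.funᴹ M g) (e M ρ σ)

    supportTerms : (f : U ⊆′ (V ∪ I)) → ∀ {Γ} (ts : All (Term L U) Γ) → SupportTerms f ts
    supportTerms f [] = [] , (λ _ ()) , [] , λ _ _ _ → refl
    supportTerms f (t ∷ ts) with supportTerm f t | supportTerms f ts
    ... | Z , c , t° , e | Z′ , d , ts° , e′ =
      Z ++ Z′ , merge c d , renameTerm (weakenˡ _) t° ∷ renameTerms (weakenʳ _ Z) ts° ,
      λ M ρ σ → cong₂ _∷_
        (trans (e M ρ σ) (sym (eval-rename M (weakenˡ _) (weakenˡ-merge M ρ σ c d) t°)))
        (trans (e′ M ρ σ) (sym (evals-rename M (weakenʳ _ Z) (weakenʳ-merge M ρ σ c d) ts°)))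

  finiteSupport : (f : U ⊆′ (V ∪ I)) (φ : Formula L U) → Support m f φ
  finiteSupport f (rel R ts) with supportTerms f ts
  ... | Z , c , ts° , e =
    support c (rel R ts°) λ M ρ σ → ≡⇒⇔ (cong (Structure.relᴹ M R) (e M ρ σ))
  finiteSupport f (t ≈' u) with supportTerm f t | supportTerm f u
  ... | Z , c , t° , e | Z′ , d , u° , e′ =
    support (merge c d) (renameTerm (weakenˡ _) t° ≈' renameTerm (weakenʳ _ Z) u°) λ M ρ σ →
      ≡⇒⇔ (cong₂ _≡_
        (trans (e M ρ σ) (sym (eval-rename M (weakenˡ _) (weakenˡ-merge M ρ σ c d) t°)))
        (trans (e′ M ρ σ) (sym (eval-rename M (weakenʳ _ Z) (weakenʳ-merge M ρ σ c d) u°))))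
  finiteSupport f ⊥' = support {tuple = []} (λ _ ()) ⊥' λ _ _ _ → ⇔-id _
  finiteSupport f (φ ∧' ψ) with finiteSupport f φ | finiteSupport f ψ
  ... | support {Z} c φ° e | support d ψ° e′ =
    support (merge c d) (rename (weakenˡ _) φ° ∧' rename (weakenʳ _ Z) ψ°) λ M ρ σ →
      (⇔-trans (e M ρ σ) (⇔-sym (⊨-rename M (weakenˡ _) φ° (weakenˡ-merge M ρ σ c d)))) ×-⇔
      (⇔-trans (e′ M ρ σ) (⇔-sym (⊨-rename M (weakenʳ _ Z) ψ° (weakenʳ-merge M ρ σ c d))))
  finiteSupport f (φ ⇒' ψ) with finiteSupport f φ | finiteSupport f ψ
  ... | support {Z} c φ° e | support d ψ° e′ =
    support (merge c d) (rename (weakenˡ _) φ° ⇒' rename (weakenʳ _ Z) ψ°) λ M ρ σ → →-cong-⇔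
      (⇔-trans (e M ρ σ) (⇔-sym (⊨-rename M (weakenˡ _) φ° (weakenˡ-merge M ρ σ c d))))
      (⇔-trans (e′ M ρ σ) (⇔-sym (⊨-rename M (weakenʳ _ Z) ψ° (weakenʳ-merge M ρ σ c d))))
  finiteSupport {U} {V} {I} f (∀' s φ) with finiteSupport f↑ φ
    where
    -- The bound variable goes to the kept side and so never enters the extracted tuple; `bind` then
    -- moves it back to where `∀'` expects it.
    f↑ : (U ∪ ｛ s ｝) ⊆′ ((V ∪ ｛ s ｝) ∪ I)
    f↑ t (inj₁ u) = [ inj₁ ∘ inj₁ , inj₂ ] (f t u)
    f↑ t (inj₂ e) = inj₁ (inj₂ e)
  ... | support {Z} c φ° e =
    support c (∀' s (rename bind φ°)) λ M ρ σ → Π-⇔ λ a →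
      let ρ↑ : (V ∪ ｛ s ｝) ⊆′ Carrier M
          ρ↑ = ρ ▹ λ { _ refl → a } in
      ⇔-trans (⊨-ext M φ λ { t (inj₁ u)    → extended M ρ σ ρ↑ (λ _ → refl) (f t u)
                           ; t (inj₂ refl) → refl })
     (⇔-trans (e M ρ↑ σ)
              (⇔-sym (⊨-rename M bind φ° λ { _ (inj₁ (inj₁ v))    → refl
                                           ; _ (inj₁ (inj₂ refl)) → refl
                                           ; _ (inj₂ z)           → refl })))
    where
    bind : ((V ∪ ｛ s ｝) ∪ (_∈ Z)) ⊆′ ((V ∪ (_∈ Z)) ∪ ｛ s ｝)
    bind _ (inj₁ (inj₁ v)) = inj₁ (inj₁ v)
    bind _ (inj₁ (inj₂ e)) = inj₂ e
    bind _ (inj₂ z)        = inj₁ (inj₂ z)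

    extended : ∀ M (ρ : V ⊆′ Carrier M) (σ : I ⊆′ Carrier M) (ρ↑ : (V ∪ ｛ s ｝) ⊆′ Carrier M) →
               (∀ {t} v → ρ↑ t (inj₁ v) ≡ ρ t v) → ∀ {t} (w : (V ∪ I) t) →
               (ρ ▹ σ) t w ≡ (ρ↑ ▹ σ) t ([ inj₁ ∘ inj₁ , inj₂ ] w)
    extended M ρ σ ρ↑ eq (inj₁ v) = sym (eq v)
    extended M ρ σ ρ↑ eq (inj₂ i) = refl

open FiniteSupport using (finiteSupport)

-- Formulas in countably many blocks of variables

Blocks : ∀ {a} {A : Set a} → List A → Pred A a → Pred A a
Blocks X P = (λ s → ℕ × s ∈ X) ∪ P

module BlockFormulas {ℓ : Level} (m : Level) (L : Language ℓ) (X : List (Language.Sort L)) (P : Vars L) where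
  open Language L

  -- The other blocks keep their numbers, so quantifying over the picked block gives a formula in
  -- the same family `Blocks X P` again, and the quantifiers of `∃blocks` can be iterated.
  pick : ℕ → Blocks X P ⊆′ ((_∈ X) ∪ Blocks X P)
  pick n s (inj₁ (i , x)) with i ≟ n
  ... | yes _ = inj₁ x
  ... | no  _ = inj₂ (inj₁ (i , x))
  pick n s (inj₂ p) = inj₂ (inj₂ p)

  inBlock : ℕ → ((_∈ X) ∪ P) ⊆′ Blocks X P
  inBlock i = (λ s x → inj₁ (i , x)) ▹ (λ s → inj₂)

  copyToBlock : ∀ {k} → (Fin k → ℕ) → Copies k X ⊆′ Blocks X P
  copyToBlock g s (u , x) = inj₁ (g u , x)

  ∃blocks : (n d : ℕ) → Formula L (Blocks X P) → Formula L (Blocks X P)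
  ∃blocks n zero    φ = φ
  ∃blocks n (suc d) φ = ∃* X (rename (pick n) (∃blocks (suc n) d φ))

  blockSupport : (φ : Formula L (Blocks X P)) →
                 Support m {I = λ s → ℕ × s ∈ X} ((λ _ → inj₂) ▹ (λ _ → inj₁)) φ
  blockSupport = finiteSupport m _

  blockBound : (φ : Formula L (Blocks X P)) →
               Σ[ n ∈ ℕ ] (∀ s z → proj₁ (Support.index (blockSupport φ) s z) < n)
  blockBound φ = bounded _ λ s z → proj₁ (Support.index (blockSupport φ) s z)

  rank : Formula L (Blocks X P) → ℕ
  rank φ = proj₁ (blockBound φ)

  -- Blocks from rank φ on do not occur in φ, so this amounts to quantifying over all
  -- blocks from the n-th on; if rank φ ≤ n it is φ itself (see ∃≥-exact).
  ∃≥ : ℕ → Formula L (Blocks X P) → Formula L (Blocks X P)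
  ∃≥ n φ = ∃blocks n (rank φ ∸ n) φ

module BlockSemantics {ℓ m : Level} {L : Language ℓ} (M : Structure L m) (X : List (Language.Sort L))
                      {P : Vars L} (p : P ⊆′ Structure.Carrier M) where
  open Language L
  open Structure M
  open BlockFormulas m L X P

  AgreeBelow : ℕ → (xs ys : ℕ → Tuple M X) → Set (ℓ Level.⊔ m)
  AgreeBelow n xs ys = ∀ i → i < n → ∀ s x → xs i s x ≡ ys i s x

  env : (ℕ → Tuple M X) → Blocks X P ⊆′ Carrier
  env xs = (λ s (i , x) → xs i s x) ▹ p

  infixl 9 _[_≔_]

  _[_≔_] : (ℕ → Tuple M X) → ℕ → Tuple M X → ℕ → Tuple M X
  (xs [ n ≔ t ]) i with i ≟ n
  ... | yes _ = t
  ... | no  _ = xs i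

  update-≢ : ∀ xs n t {i} → i ≢ n → ∀ s x → (xs [ n ≔ t ]) i s x ≡ xs i s x
  update-≢ xs n t {i} i≢n s x with i ≟ n
  ... | yes i≡n = ⊥-elim (i≢n i≡n)
  ... | no  _   = refl

  update-agree : ∀ {n xs ys} → AgreeBelow n xs ys → AgreeBelow (suc n) (xs [ n ≔ ys n ]) ys
  update-agree {n} eq i i<1+n s x with i ≟ n
  ... | yes refl = refl
  ... | no  i≢n  = eq i (≤∧≢⇒< (ℕ.s≤s⁻¹ i<1+n) i≢n) s x

  -- `φ` is equivalent to its supporting formula, whose block variables all lie in blocks below
  -- `rank φ`.
  ⊨-agree : (φ : Formula L (Blocks X P)) → ∀ {n} → rank φ ≤ n → ∀ {xs ys} → AgreeBelow n xs ys →
            M ⊨ φ [ env xs ] ⇔ M ⊨ φ [ env ys ]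
  ⊨-agree φ r≤n {xs} {ys} eq =
    ⇔-trans (reduce xs) (⇔-trans
      (⊨-ext M (Support.formula S) λ where
        s (inj₁ v) → refl
        s (inj₂ z) → eq _ (≤-trans (proj₂ (blockBound φ) s z) r≤n) s _)
      (⇔-sym (reduce ys)))
    where
    S = blockSupport φ

    reduce : ∀ xs → M ⊨ φ [ env xs ] ⇔
                    M ⊨ Support.formula S [ p ▹ (λ s z → let (i , x) = Support.index S s z in xs i s x) ]
    reduce xs = ⇔-trans (⊨-ext M φ λ { s (inj₁ _) → refl ; s (inj₂ _) → refl })
                        (Support.⊨-formula S M p (λ s (i , x) → xs i s x))

  ⊨-pick : ∀ n (φ : Formula L (Blocks X P)) {xs t} →
           M ⊨ rename (pick n) φ [ t ▹ env xs ] ⇔ M ⊨ φ [ env (xs [ n ≔ t ]) ]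
  ⊨-pick n φ {xs} {t} = ⊨-rename M (pick n) φ eq
    where
    eq : ∀ s v → (t ▹ env xs) s (pick n s v) ≡ env (xs [ n ≔ t ]) s v
    eq s (inj₁ (i , x)) with i ≟ n
    ... | yes _ = refl
    ... | no  _ = refl
    eq s (inj₂ _) = refl

  ⊨-inBlock : ∀ i (φ : Formula L ((_∈ X) ∪ P)) {xs} →
              M ⊨ rename (inBlock i) φ [ env xs ] ⇔ M ⊨ φ [ xs i ▹ p ]
  ⊨-inBlock i φ = ⊨-rename M (inBlock i) φ λ { s (inj₁ x) → refl ; s (inj₂ y) → refl }

  ⊨-copyToBlock : ∀ {k} (g : Fin k → ℕ) (φ : Formula L (Copies k X)) {xs} →
                  M ⊨ rename (copyToBlock g) φ [ env xs ] ⇔ M ⊨ φ [ (λ s (u , x) → xs (g u) s x) ]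
  ⊨-copyToBlock g φ = ⊨-rename M (copyToBlock g) φ λ _ _ → refl

  -- The witnesses for blocks n, n+1, ... are read off from `ys`. After d of them the two sequences
  -- agree below n + d, hence on every block that occurs in `φ`.
  ∃blocks-intro : ∀ n d (φ : Formula L (Blocks X P)) → rank φ ≤ n + d → ∀ {xs ys} →
                  AgreeBelow n xs ys → M ⊨ φ [ env ys ] →
                  M ⊨ ∃blocks n d φ [ env xs ]
  ∃blocks-intro n zero φ r≤ eq h = from (⊨-agree φ (subst (rank φ ≤_) (+-identityʳ n) r≤) eq) h
  ∃blocks-intro n (suc d) φ r≤ {xs} {ys} eq h = from (⊨-∃* M X _) λ none → none
    (ys n , from (⊨-pick n (∃blocks (suc n) d φ))
                 (∃blocks-intro (suc n) d φ (subst (rank φ ≤_) (+-suc n d) r≤) (update-agree eq) h))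

  ∃blocks-elim : ∀ n d (φ : Formula L (Blocks X P)) {xs} → M ⊨ ∃blocks n d φ [ env xs ] →
                 ¬ ¬ (Σ[ ys ∈ (ℕ → Tuple M X) ] AgreeBelow n xs ys × M ⊨ φ [ env ys ])
  ∃blocks-elim n zero    φ {xs} h none = none (xs , (λ _ _ _ _ → refl) , h)
  ∃blocks-elim n (suc d) φ {xs} h none = to (⊨-∃* M X _) h λ (t , ht) →
    ∃blocks-elim (suc n) d φ (to (⊨-pick n (∃blocks (suc n) d φ)) ht) λ (ys , eq , hys) →
      none (ys , (λ i i<n s x → trans (sym (update-≢ xs n t (<⇒≢ i<n) s x))
                                      (eq i (m<n⇒m<1+n i<n) s x)) , hys)

  ∃≥-intro : ∀ n (φ : Formula L (Blocks X P)) {xs ys} → AgreeBelow n xs ys →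
             M ⊨ φ [ env ys ] → M ⊨ ∃≥ n φ [ env xs ]
  ∃≥-intro n φ = ∃blocks-intro n (rank φ ∸ n) φ (m≤n+m∸n (rank φ) n)

  ∃≥-elim : ∀ n (φ : Formula L (Blocks X P)) {xs} → M ⊨ ∃≥ n φ [ env xs ] →
            ¬ ¬ (Σ[ ys ∈ (ℕ → Tuple M X) ] AgreeBelow n xs ys × M ⊨ φ [ env ys ])
  ∃≥-elim n φ = ∃blocks-elim n (rank φ ∸ n) φ

  ∃≥-exact : ∀ n (φ : Formula L (Blocks X P)) {xs} → rank φ ≤ n →
             M ⊨ ∃≥ n φ [ env xs ] → M ⊨ φ [ env xs ]
  ∃≥-exact n φ r≤n h rewrite m≤n⇒m∸n≡0 r≤n = h

-- Saturation for types in countably many variables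

module ωSaturation {ℓ m : Level} {L : Language ℓ} (M : Structure L m) (saturated : Saturated M)
                   (C : SmallSet M) (X : List (Language.Sort L))
                   (q : Pred (Formula L (Blocks X (SmallSet.Index C))) (ℓ Level.⊔ m)) where
  open Language L
  open Structure M
  open SmallSet
  open BlockFormulas m L X (Index C)
  open BlockSemantics M X (elem C)

  Extends : ℕ → (ℕ → Tuple M X) → Set (ℓ Level.⊔ m)
  Extends n xs = ∀ φs → All q φs →
                 ¬ ¬ (Σ[ ys ∈ (ℕ → Tuple M X) ] AgreeBelow n xs ys × M ⊨ ⋀ φs [ env ys ])

  -- Stronger than Extends: once n exceeds the rank of a formula in q, it gives the truth of
  -- that formula and not just of its double negation.
  Closed : ℕ → (ℕ → Tuple M X) → Set (ℓ Level.⊔ m)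
  Closed n xs = ∀ φs → All q φs → M ⊨ ∃≥ n (⋀ φs) [ env xs ]

  Closed⇒Extends : ∀ {n xs} → Closed n xs → Extends n xs
  Closed⇒Extends {n} closed φs all = ∃≥-elim n (⋀ φs) (closed φs all)

  -- The demand on block n, given the earlier blocks: every finite part of `q` can still be
  -- completed by a choice of the later ones.
  data NextType (n : ℕ) : Formula L ((_∈ X) ∪ Blocks X (Index C)) → Set (ℓ Level.⊔ m) where
    next : ∀ φs → All q φs → NextType n (rename (pick n) (∃≥ (suc n) (⋀ φs)))

  -- The finite parts behind `χs` are joined into one list, so that block n of a single completion
  -- serves all of `χs` at once.
  gather : ∀ n xs χs → All (NextType n) χs →
           Σ[ φs ∈ List (Formula L (Blocks X (Index C))) ] All q φs ×
           (∀ ys → AgreeBelow n xs ys → M ⊨ ⋀ φs [ env ys ] → M ⊨ ⋀ χs [ ys n ▹ env xs ])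
  gather n xs [] [] = [] , [] , λ _ _ _ → id
  gather n xs (_ ∷ χs) (next φs all ∷ nexts) with gather n xs χs nexts
  ... | φs′ , all′ , imp = φs ++ φs′ , ++⁺ all all′ , λ ys eq h →
    let hs = to (⊨-⋀ M (φs ++ φs′)) h in
    from (⊨-pick n (∃≥ (suc n) (⋀ φs)))
         (∃≥-intro (suc n) (⋀ φs) (update-agree eq) (from (⊨-⋀ M φs) (++⁻ˡ φs hs))) ,
    imp ys eq (from (⊨-⋀ M φs′) (++⁻ʳ φs hs))

  -- Saturation is applied over `C` together with the entries of `xs`. Of these only the blocks
  -- below n matter, because `pick n` and `∃≥ (suc n)` capture the others. Finite satisfiability is
  -- a doubly negated statement, whereas a realisation makes the formulas of the type true outright;
  -- this turns `Extends` into `Closed`.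
  step : ∀ n xs → Extends n xs → Σ[ t ∈ Tuple M X ] Closed (suc n) (xs [ n ≔ t ])
  step n xs ext with saturated (smallSet (Blocks X (Index C)) (env xs)) X (NextType n) satisfiable
    where
    satisfiable : FinitelySatisfiable M (smallSet (Blocks X (Index C)) (env xs)) (NextType n)
    satisfiable χs nexts with gather n xs χs nexts
    ... | φs , all , imp = from (⊨-∃* M X (⋀ χs)) λ none →
      ext φs all λ (ys , eq , h) → none (ys n , imp ys eq h)
  ... | t , real = t , λ φs all → to (⊨-pick n (∃≥ (suc n) (⋀ φs))) (real _ (next φs all))

  module _ (satisfiable : ∀ φs → All q φs → ¬ ¬ (Σ[ ys ∈ (ℕ → Tuple M X) ] M ⊨ ⋀ φs [ env ys ])) where

    stage : ∀ n → Σ[ xs ∈ (ℕ → Tuple M X) ] Closed (suc n) xs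
    -- The initial sequence is a default: no block lies below 0, so there is nothing to agree with.
    stage zero with step 0 (λ _ s _ → inhabited s)
                      (λ φs all none → satisfiable φs all λ (ys , h) → none (ys , (λ _ ()) , h))
    ... | t , closed = _ , closed
    stage (suc n) with stage n
    ... | xs , closed with step (suc n) xs (Closed⇒Extends closed)
    ...   | t , closed′ = _ , closed′

    -- A diagonal: block i is settled at stage i, and each later stage changes only the block of its
    -- own number.
    limit : ℕ → Tuple M X
    limit i = proj₁ (stage i) i

    stage-limit : ∀ n → AgreeBelow (suc n) (proj₁ (stage n)) limit
    stage-limit zero    zero    _       s x = refl
    stage-limit zero    (suc _) (s≤s ())
    stage-limit (suc n) i       i<2+n    s x with m≤n⇒m<n∨m≡n (ℕ.s≤s⁻¹ i<2+n)
    ... | inj₂ refl  = refl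
    ... | inj₁ i<1+n = trans (update-≢ (proj₁ (stage n)) (suc n) _ (<⇒≢ i<1+n) s x)
                             (stage-limit n i i<1+n s x)

    ω-saturated : Σ[ ys ∈ (ℕ → Tuple M X) ] (∀ φ → q φ → M ⊨ φ [ env ys ])
    ω-saturated = limit , λ φ qφ →
      -- Stage n has settled blocks 0 to n, which include all blocks of a formula of rank n; so
      -- `∃≥ (suc n)` binds nothing, and truth passes from the stage to the limit.
      let n = rank (⋀ (φ ∷ [])) ; (xs , closed) = stage n in
      proj₁ (to (⊨-agree (⋀ (φ ∷ [])) (n≤1+n n) (stage-limit n))
                (∃≥-exact (suc n) (⋀ (φ ∷ [])) (n≤1+n n) (closed (φ ∷ []) (qφ ∷ []))))

-- Transitivity

module Obstruction {ℓ : Level} (m : Level) {L : Language ℓ} {X Z : List (Language.Sort L)} (N : ℕ)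
                   (δ : Formula L ((_∈ X) ∪ (_∈ Z))) (ψ : Formula L (Copies (suc N) X)) where
  open BlockFormulas m L X (_∈ Z)

  exchange : ((_∈ X) ∪ (_∈ Z)) ⊆′ ((_∈ Z) ∪ (_∈ X))
  exchange = (λ s → inj₂) ▹ (λ s → inj₁)

  collapse : Blocks X (_∈ Z) ⊆′ ((_∈ Z) ∪ (_∈ X))
  collapse = (λ s (i , x) → inj₂ x) ▹ (λ s → inj₁)

  system : Formula L (Blocks X (_∈ Z))
  system = ⋀ (map (λ u → rename (inBlock (toℕ u)) δ) (allFin (suc N))) ∧' rename (copyToBlock toℕ) ψ

  -- The second conjunct is the θ(z) of the introduction: ∃≥ 0 binds every block that occurs
  -- in system, so how collapse renames the blocks does not affect its truth.
  obstruction : FormulaPair L Z X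
  obstruction = pair (rename exchange δ ∧' ¬' rename collapse (∃≥ 0 system)) ψ

  module _ (M : Structure L m) (z : Tuple M Z) where
    open BlockSemantics M X z

    ⊨-system : ∀ {xs} → M ⊨ system [ env xs ] ⇔
               ((∀ u → M ⊨ δ [ xs (toℕ {suc N} u) ▹ z ]) × M ⊨ ψ [ (λ s (u , x) → xs (toℕ u) s x) ])
    ⊨-system = ⇔-trans (⊨-⋀-allFin M _) (Π-⇔ λ u → ⊨-inBlock (toℕ u) δ) ×-⇔ ⊨-copyToBlock toℕ ψ

    ⊨-obstruction : ∀ {x : Tuple M X} → M ⊨ FormulaPair.φ obstruction [ z ▹ x ] ⇔
                    (M ⊨ δ [ x ▹ z ] × ¬ (Σ[ xs ∈ (ℕ → Tuple M X) ] M ⊨ system [ env xs ]))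
    ⊨-obstruction {x} =
      ⊨-rename M exchange δ (λ { s (inj₁ x) → refl ; s (inj₂ z) → refl }) ×-⇔ mk⇔
        (λ h (xs , hxs) → lower (h (from ⊨-collapse (∃≥-intro 0 system (λ _ ()) hxs))))
        (λ none h → lift (∃≥-elim 0 system (to ⊨-collapse h) λ (xs , _ , hxs) → none (xs , hxs)))
      where
      ⊨-collapse : M ⊨ rename collapse (∃≥ 0 system) [ z ▹ x ] ⇔ M ⊨ ∃≥ 0 system [ env (λ _ → x) ]
      ⊨-collapse = ⊨-rename M collapse (∃≥ 0 system) λ { s (inj₁ _) → refl ; s (inj₂ _) → refl }

  -- Tuples satisfying all copies and `ψ` would solve `system`, which the second conjunct of each
  -- copy denies. Having `suc N` copies guarantees that there is a copy, here number zero, to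
  -- contradict.
  obstruction∈Ξ : (T : Theory L) → Ξ m T obstruction
  obstruction∈Ξ T M _ ρ (hφ , hψ) = proj₂ (holds zero)
    -- `system` concerns blocks 0 to N only; the values beyond N are fillers.
    ( (λ i → y (clamp N i))
    , from (⊨-system M z) ((λ u → proj₁ (holds (clamp N (toℕ u))))
                          , to (⊨-rename M _ ψ λ s (u , x) → cong (λ v → y v s x) (sym (clamp-toℕ N u))) hψ) )
    where
    z : Tuple M Z
    z s i = ρ s (inj₁ i)

    y : Fin (suc N) → Tuple M X
    y u s x = ρ s (inj₂ (u , x))

    holds : ∀ u → M ⊨ δ [ y u ▹ z ] × ¬ _
    holds u = to (⊨-obstruction M z)
      (to (⊨-rename M _ (FormulaPair.φ obstruction) λ { s (inj₁ _) → refl ; s (inj₂ _) → refl })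
          (to (⊨-⋀-allFin M _) hφ u))

module SpreadSequences {ℓ m : Level} {L : Language ℓ} (M : Structure L m) (saturated : Saturated M)
                  {X : List (Language.Sort L)} {k : ℕ} (ψ : Formula L (Copies k X))
                  (a : Tuple M X) (C : SmallSet M) where
  open Language L
  open Structure M
  open SmallSet
  open BlockFormulas m L X (Index C)
  open BlockSemantics M X (elem C)

  Spread : (ℕ → Tuple M X) → Set m
  Spread xs = ∀ (g : Fin k → ℕ) → Increasing g → M ⊨ ψ [ (λ s (u , x) → xs (g u) s x) ]

  data SpreadType : Formula L (Blocks X (Index C)) → Set (ℓ Level.⊔ m) where
    inType : ∀ i χ → tp M a C χ → SpreadType (rename (inBlock i) χ)
    spread : ∀ g → Increasing g → SpreadType (rename (copyToBlock g) ψ)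

  open ωSaturation M saturated C X SpreadType using (ω-saturated)

  -- The block to which each formula of the type refers is forgotten: all of `χs` is required of
  -- every block. This is no loss, as the formulas come from one type, and it leaves a single
  -- formula `⋀ χs` for the obstruction.
  gather : ∀ φs → All SpreadType φs →
           Σ[ χs ∈ List (FormulaOver M C X) ] All (tp M a C) χs ×
           (Σ[ gs ∈ List (Fin k → ℕ) ] All Increasing gs ×
           (∀ {xs} → (∀ i → M ⊨ ⋀ χs [ xs i ▹ elem C ]) →
                     All (λ g → M ⊨ ψ [ (λ s (u , x) → xs (g u) s x) ]) gs → M ⊨ ⋀ φs [ env xs ]))
  gather [] [] = [] , [] , [] , [] , λ _ _ → id
  gather (_ ∷ φs) (inType i χ χ∈tp ∷ all) with gather φs all
  ... | χs , χs∈tp , gs , incs , imp =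
    χ ∷ χs , χ∈tp ∷ χs∈tp , gs , incs ,
    λ hχ hg → from (⊨-inBlock i χ) (proj₁ (hχ i)) , imp (proj₂ ∘ hχ) hg
  gather (_ ∷ φs) (spread g inc ∷ all) with gather φs all
  ... | χs , χs∈tp , gs , incs , imp =
    χs , χs∈tp , g ∷ gs , inc ∷ incs ,
    λ { hχ (h ∷ hg) → from (⊨-copyToBlock g ψ) h , imp hχ hg }

  spreadRealisations : (∀ φs → All SpreadType φs → ¬ ¬ (Σ[ xs ∈ (ℕ → Tuple M X) ] M ⊨ ⋀ φs [ env xs ])) →
                       Σ[ xs ∈ (ℕ → Tuple M X) ] (∀ i → Realises M C (xs i) (tp M a C)) × Spread xs
  spreadRealisations satisfiable with ω-saturated satisfiable
  ... | xs , real = xs , (λ i χ χ∈tp → to (⊨-inBlock i χ) (real _ (inType i χ χ∈tp)))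
                       , (λ g inc → to (⊨-copyToBlock g ψ) (real _ (spread g inc)))

  module _ (T : Theory L) (D : SmallSet M) (independent : Independent M (Ξ m T) C D (entries M a))
           (bs : ℕ → Tuple M X) (bs-real : ∀ i → Realises M D (bs i) (tp M a D))
           (bs-spread : Spread bs) where

    satisfiable : ∀ φs → All SpreadType φs → ¬ ¬ (Σ[ xs ∈ (ℕ → Tuple M X) ] M ⊨ ⋀ φs [ env xs ])
    satisfiable φs all none with gather φs all
    ... | χs , χs∈tp , gs , incs , imp =
      -- The tuple from `C` consists of the finitely many parameters of `χs`, and the parameter of
      -- the dividing formula is `a` itself.
      independent (_ , index , _ , obstruction , (λ s → inj₁) , obstruction∈Ξ T ,
        from (⊨-rename M _ (FormulaPair.φ obstruction) λ { s (inj₁ _) → refl ; s (inj₂ _) → refl })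
             (from (⊨-obstruction M c) (to δ⇔χs (from (⊨-⋀ M χs) χs∈tp) , no-solution)) ,
        -- The given sequence is reused unchanged: an increasing choice of N + 1 indices composed
        -- with a clamped `g` is increasing again, so `ψ` holds along it.
        bs , bs-real , λ i inc → from (⊨-ψs (λ u → bs (i u))) (All.tabulate λ {g} g∈gs →
          bs-spread (λ v → i (clamp N (g v))) (λ u<v → inc (clamp-increasing g∈gs u<v))))
      where
      open Support (finiteSupport m {V = _∈ X} {I = Index C} (λ s → id) (⋀ χs))
        using (tuple; index) renaming (formula to δ; ⊨-formula to ⊨-δ)

      c : Tuple M tuple
      c s i = elem C s (index s i)

      δ⇔χs : ∀ {x : Tuple M X} → M ⊨ ⋀ χs [ x ▹ elem C ] ⇔ M ⊨ δ [ x ▹ c ]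
      δ⇔χs {x} = ⊨-δ M x (elem C)

      -- `N` exceeds every value of every `g` in `gs`, so that clamping leaves these values
      -- unchanged and keeps each `g` increasing.
      bound : Σ[ N ∈ ℕ ] (∀ g → g ∈ gs → _ < N)
      bound = bounded gs λ g _ → proj₁ (bounded (allFin k) λ v _ → g v)

      N : ℕ
      N = proj₁ bound

      gs<N : ∀ {g} → g ∈ gs → ∀ v → g v < suc N
      gs<N {g} g∈gs v = m<n⇒m<1+n (<-trans (proj₂ (bounded (allFin k) λ v _ → g v) v (∈-allFin v))
                                             (proj₂ bound g g∈gs))

      clamp-increasing : ∀ {g} → g ∈ gs → ∀ {u v} → u <ᶠ v → clamp N (g u) <ᶠ clamp N (g v)
      clamp-increasing g∈gs {u} {v} u<v
        rewrite toℕ-clamp N (gs<N g∈gs u) | toℕ-clamp N (gs<N g∈gs v) = All.lookup incs g∈gs u<v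

      copy : (Fin k → ℕ) → Copies k X ⊆′ Copies (suc N) X
      copy g s (v , x) = clamp N (g v) , x

      ψs : Formula L (Copies (suc N) X)
      ψs = ⋀ (map (λ g → rename (copy g) ψ) gs)

      ⊨-ψs : ∀ (y : Fin (suc N) → Tuple M X) → M ⊨ ψs [ (λ s (u , x) → y u s x) ] ⇔
             All (λ g → M ⊨ ψ [ (λ s (v , x) → y (clamp N (g v)) s x) ]) gs
      ⊨-ψs y = ⇔-trans (⊨-⋀ M _) (mk⇔
        (All.map (λ {g} → to (⊨-rename M (copy g) ψ λ _ _ → refl)) ∘ map⁻)
        (map⁺ ∘ All.map (λ {g} → from (⊨-rename M (copy g) ψ λ _ _ → refl))))

      open Obstruction m N δ ψs

      no-solution : ¬ (Σ[ xs ∈ (ℕ → Tuple M X) ] M ⊨ system [ BlockSemantics.env M X c xs ])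
      no-solution (xs , h) with to (⊨-system M c) h
      -- A solution of `system` is controlled only on blocks 0 to N, while `imp` asks for `χs` on
      -- every block; clamping the index fills the remaining blocks with controlled ones.
      ... | hδ , hψ = none ((λ i → xs (toℕ (clamp N i))) ,
        imp (λ i → from δ⇔χs (hδ (clamp N i))) (to (⊨-ψs (λ u → xs (toℕ u))) hψ))

Ξ-transitive : ∀ {ℓ m : Level} {L : Language ℓ} (T : Theory L) (M : Structure L m) → Saturated M →
               Transitive M (Ξ m T)
Ξ-transitive T M saturated (pair φ ψ) _ C D a _ independent (bs , bs-real , bs-spread) =
  let open SpreadSequences M saturated ψ a C
      (xs , real , xs-spread) = spreadRealisations
        (satisfiable T D independent bs bs-real λ g inc → to (⊨-ext M ψ λ _ _ → refl) (bs-spread g inc))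
  in xs , real , λ g inc → to (⊨-ext M ψ λ _ _ → refl) (xs-spread g inc)

-- Normality

-- For k = 0 no z̄ᵢ is available and inhabitedness of the sorts is needed.
allEqual-common : ∀ {ℓ m : Level} {L : Language ℓ} (M : Structure L m) k (Z : List (Language.Sort L))
                  {τ : Copies k Z ⊆′ Structure.Carrier M} → M ⊨ allEqual k Z [ τ ] →
                  Σ[ z ∈ Tuple M Z ] (∀ i s x → τ s (i , x) ≡ z s x)
allEqual-common M zero    Z _ = (λ s _ → Structure.inhabited M s) , λ ()
allEqual-common M (suc n) Z {τ} h = (λ s x → τ s (zero , x)) ,
  <-weakInduction (λ i → ∀ s x → τ s (i , x) ≡ τ s (zero , x)) (λ _ _ → refl)
    λ i eq s x → trans (sym (⊨-⋀-mapWith∈ M Z _ (to (⊨-⋀-allFin M _) h i) x)) (eq s x)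

Ξ-normal : ∀ {ℓ m : Level} {L : Language ℓ} (T : Theory L) → Normal (Ξ m T)
Ξ-normal T X Z {Y} (pair {k} φ ψ) φψ∈Ξ M M⊨T ρ (hφ , hψ , hZ)
  with allEqual-common M k Z {λ s (i , x) → ρ s (inj₂ (i , ∈-++⁺ˡ x))}
         (to (⊨-rename² M _ _ (allEqual k Z) λ _ _ → refl) hZ)
... | z , common = φψ∈Ξ M M⊨T σ
    -- Read from the inside out: copy i of the shifted formula is evaluated in its own variables,
    -- the regrouping of z̄ is undone, and the result is placed as copy i of the original formula.
    ( from (⊨-⋀-allFin M _) (λ i →
        from (⊨-rename M _ φ {ρ = shifted-env i} λ { s (inj₁ v) → refl ; s (inj₂ y) → refl })
          (to (⊨-rename M _ φ λ { s (inj₁ v) → regrouped i s (∈-++⁻ X v) ; s (inj₂ y) → refl })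
            (to (⊨-rename M _ (rename _ φ) {ρ = pair-env i} λ { s (inj₁ v) → refl ; s (inj₂ y) → refl })
              (to (⊨-⋀-allFin M _) hφ i))))
    , from (⊨-rename M _ ψ λ _ _ → refl) (to (⊨-rename² M _ _ ψ λ _ _ → refl) hψ) )
  where
  open Structure M

  x+z : Tuple M (X ++ Z)
  x+z s v = [ (λ x → ρ s (inj₁ x)) , z s ] (∈-++⁻ X v)

  shifted-env : Fin k → ((_∈ (X ++ Z)) ∪ (_∈ Y)) ⊆′ Carrier
  shifted-env i = x+z ▹ (λ s y → ρ s (inj₂ (i , ∈-++⁺ʳ Z y)))

  σ : ((_∈ (X ++ Z)) ∪ Copies k Y) ⊆′ Carrier
  σ = x+z ▹ (λ s (i , y) → ρ s (inj₂ (i , ∈-++⁺ʳ Z y)))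

  pair-env : Fin k → ((_∈ X) ∪ (_∈ (Z ++ Y))) ⊆′ Carrier
  pair-env i = (λ s x → ρ s (inj₁ x)) ▹ (λ s y → ρ s (inj₂ (i , y)))

  -- Here the equality of the z̄ᵢ enters: the z̄ᵢ of copy i is replaced by the value common to all
  -- copies.
  regrouped : ∀ i s (v : ((_∈ X) ∪ (_∈ Z)) s) →
              pair-env i s ([ inj₁ , inj₂ ∘ ∈-++⁺ˡ ] v) ≡ [ (λ x → ρ s (inj₁ x)) , z s ] v
  regrouped i s (inj₁ x) = refl
  regrouped i s (inj₂ x) = common i s x

mainTheorem8 : ∀ {ℓ m : Level} {L : Language ℓ} (T : Theory L) → Consistent m T → Complete m T →
    (𝕄 : BigModel m T) →
    Transitive (BigModel.model 𝕄) (Ξ m T) × Normal (Ξ m T)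
mainTheorem8 T _ _ 𝕄 = Ξ-transitive T model saturated , Ξ-normal T
  where open BigModel 𝕄
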